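{- Let $E_n$ be the Euler numbers, defined by $\sum_{n\ge0}E_n\frac{x^n}{n!}=\operatorname{sech}x$, and let $F_n=nE_{n-1}$ (so that $\sum_{n\ge0}F_n\frac{x^n}{n!}=x\operatorname{sech}x$). For a nonnegative integer $n$ and an odd positive integer $j$, let $2^{\mu_{j,n}}$ be the highest power of $2$ dividing \[\sum_{i=0}^n(-1)^{n-i}\binom ni F_{2i+j}.\] Then $\mu_{j,0}=0$, $\mu_{j,1}=2$, and for $n>1$, $\mu_{j,n}=3n$ if $n$ is odd and $\mu_{j,n}=3n-1$ if $n$ is even. -}

module Defs where

open import Data.Nat using (ℕ; zero; suc; _≤?_; _∸_; _^_; _%_)
open import Data.Nat.Combinatorics using (_C_)
open import Data.Integer using (ℤ; +_; -_; _+_; _*_; 0ℤ; 1ℤ)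
open import Data.Integer.Divisibility using (_∣_)
open import Data.List using (List; upTo; map; foldr)
open import Data.Bool using (Bool; true; false; if_then_else_)
open import Relation.Nullary using (¬_; does)
open import Data.Product using (_×_)

isEven : ℕ → Bool
isEven zero = true
isEven (suc zero) = false
isEven (suc (suc n)) = isEven n

sumTo : ℕ → (ℕ → ℤ) → ℤ
sumTo n f = foldr _+_ 0ℤ (map f (upTo (suc n)))

-- Euler numbers (sech x = Σ E_n x^n / n!), from cosh x · sech x = 1:
--   Σ_{k=0}^{m} [m-k even] C(m,k) E_k = δ_{m,0},
-- i.e. E_0 = 1 and, for m = n+1,
--   E_{n+1} = - Σ_{k=0}^{n} [n+1-k even] C(n+1,k) E_k .
-- eulerTab n k = E_k for all k ≤ n.
eulerNext : ℕ → (ℕ → ℤ) → ℤ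
eulerNext n f =
  - sumTo n (λ k → if isEven (suc n ∸ k) then (+ (suc n C k)) * f k else 0ℤ)

eulerTab : ℕ → ℕ → ℤ
eulerTab zero _ = 1ℤ
eulerTab (suc n) k =
  if does (k ≤? n) then eulerTab n k else eulerNext n (eulerTab n)

E : ℕ → ℤ
E n = eulerTab n n

F : ℕ → ℤ
F zero = 0ℤ
F (suc m) = (+ suc m) * E m

S : ℕ → ℕ → ℤ
S j n = sumTo n (λ i →
  (if isEven (n ∸ i) then 1ℤ else - 1ℤ) * ((+ (n C i)) * F (2 Data.Nat.* i Data.Nat.+ j)))

HighestPow2 : ℕ → ℤ → Set
HighestPow2 m z = ((+ (2 ^ m)) ∣ z) × ¬ ((+ (2 ^ suc m)) ∣ z)

{-# OPTIONS --safe #-}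
-- With p(x) = x^j (x² − 1)^n and x^r read umbrally as F_r, the sum is M[p] for a linear
-- functional M. Since sech · cosh = 1, the Appell polynomials A_r of the Euler numbers satisfy
-- A_r(y + 1) + A_r(y − 1) = 2 y^r; telescoping from 0 to 4N and expanding A_r(4N) to second
-- order gives Σ_{k<N} (p(4k + 3) − p(4k + 1)) ≡ 2N M[p] modulo 8N².
-- For odd x, x² − 1 is 8 times a triangular number, so this sum is 8^n times
-- Σ_{k<N} ((4k + 3)^j t₃(k)^n − (4k + 1)^j t₁(k)^n). For N = 2^s, doubling N doubles such a
-- polynomial sum up to an error of order N²/2, so that its valuation is s for n = 1 and even
-- n ≥ 2, and s + 1 for n = 0 and odd n ≥ 3, once this is known for s = 4, i.e. for 16 terms
-- modulo 64, where the dependence on j disappears and that on n is periodic.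
module Submission where

open import Defs
open import Data.Bool using (true; false; if_then_else_)
open import Data.Integer using (ℤ; +_; -_; 0ℤ; 1ℤ; -1ℤ; ∣_∣) renaming (_+_ to _⊕_; _*_ to _⊗_; _-_ to _⊖_; _^_ to _↑_)
open import Data.Integer.Divisibility.Signed using (_∣_; divides; _∣?_; ∣⇒∣ᵤ; ∣ᵤ⇒∣; ∣m∣n⇒∣m+n; ∣n⇒∣m*n)
open import Data.Integer.Properties using (*-zeroˡ; *-zeroʳ; *-identityˡ; *-identityʳ; *-distribˡ-+; *-distribʳ-+; *-cancelˡ-≡; *-assoc; *-comm; +-identityˡ; +-identityʳ; ^-distribˡ-+-*; pos-+; pos-*; +-inverseʳ; +-assoc)
open import Data.Integer.Tactic.RingSolver using (solve-∀)
open import Data.List using (applyUpTo; foldr)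
open import Data.List.Properties using (map-upTo)
open import Data.Nat using (ℕ; zero; suc; _+_; _<_; _≤_; _≤?_; _*_; _∸_; _^_; _%_; z≤n; s≤s; NonZero)
open import Data.Nat.Combinatorics using (_C_; nCk+nC[k+1]≡[n+1]C[k+1]; nCn≡1)
open import Data.Nat.Combinatorics.Specification using (k>n⇒nCk≡0)
open import Data.Nat.Properties using (≤-refl; m≤n⇒m<n∨m≡n; m≤n⇒m≤1+n; n<1+n; n∸n≡0; allUpTo?)
import Data.Nat.Divisibility as ℕ
import Data.Nat.Properties as ℕ
open import Data.Nat.DivMod using (_/_; m≡m%n+[m/n]*n; m%n<n)
open import Data.Sum using (inj₁; inj₂)
open import Data.Product using (_×_; _,_; ∃; proj₁; proj₂)
open import Function using (_∘_)
open import Relation.Binary.PropositionalEquality using (_≡_; refl; sym; trans; cong; cong₂; subst; module ≡-Reasoning)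
open import Relation.Nullary using (Dec; contradiction)
open import Relation.Nullary.Decidable using (dec-true; dec-false; map′; toWitness; from-no)

open ≡-Reasoning

-- Finite sums of integers.

+-interchange : ∀ a b c d → (a ⊕ b) ⊕ (c ⊕ d) ≡ (a ⊕ c) ⊕ (b ⊕ d)
+-interchange = solve-∀

Σ< : ℕ → (ℕ → ℤ) → ℤ
Σ< zero    f = 0ℤ
Σ< (suc n) f = Σ< n f ⊕ f n

Σ<-cong : ∀ n {f g : ℕ → ℤ} → (∀ k → k < n → f k ≡ g k) → Σ< n f ≡ Σ< n g
Σ<-cong zero    eq = refl
Σ<-cong (suc n) eq = cong₂ _⊕_ (Σ<-cong n (λ k k<n → eq k (m≤n⇒m≤1+n k<n))) (eq n (n<1+n n))

Σ<-+ : ∀ n (f g : ℕ → ℤ) → Σ< n (λ k → f k ⊕ g k) ≡ Σ< n f ⊕ Σ< n g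
Σ<-+ zero    f g = refl
Σ<-+ (suc n) f g = trans (cong (_⊕ (f n ⊕ g n)) (Σ<-+ n f g)) (+-interchange (Σ< n f) (Σ< n g) (f n) (g n))

Σ<-*ˡ : ∀ n x (f : ℕ → ℤ) → Σ< n (λ k → x ⊗ f k) ≡ x ⊗ Σ< n f
Σ<-*ˡ zero    x f = sym (*-zeroʳ x)
Σ<-*ˡ (suc n) x f = trans (cong (_⊕ (x ⊗ f n)) (Σ<-*ˡ n x f)) (sym (*-distribˡ-+ x _ _))

Σ<-suc : ∀ n (f : ℕ → ℤ) → Σ< (suc n) f ≡ f 0 ⊕ Σ< n (f ∘ suc)
Σ<-suc zero    f = trans (+-identityˡ (f 0)) (sym (+-identityʳ (f 0)))
Σ<-suc (suc n) f = trans (cong (_⊕ f (suc n)) (Σ<-suc n f)) (+-assoc (f 0) (Σ< n (f ∘ suc)) (f (suc n)))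

Σ<-split : ∀ m n (f : ℕ → ℤ) → Σ< (m + n) f ≡ Σ< m f ⊕ Σ< n (λ k → f (m + k))
Σ<-split m zero    f rewrite ℕ.+-identityʳ m = sym (+-identityʳ _)
Σ<-split m (suc n) f rewrite ℕ.+-suc m n = trans (cong (_⊕ f (m + n)) (Σ<-split m n f)) (+-assoc (Σ< m f) (Σ< n (λ k → f (m + k))) (f (m + n)))

sumTo≡Σ< : ∀ n (f : ℕ → ℤ) → sumTo n f ≡ Σ< (suc n) f
sumTo≡Σ< n f = trans (cong (foldr _⊕_ 0ℤ) (map-upTo f (suc n))) (go (suc n) f)
  where
  go : ∀ n (f : ℕ → ℤ) → foldr _⊕_ 0ℤ (applyUpTo f n) ≡ Σ< n f
  go zero    f = refl
  go (suc n) f = trans (cong (f 0 ⊕_) (go n (f ∘ suc))) (sym (Σ<-suc n f))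

-- Binomial convolution of sequences.

-- Binomial convolution, i.e. the product of exponential generating functions; the
-- recursion is Leibniz's rule.
conv : (ℕ → ℤ) → (ℕ → ℤ) → ℕ → ℤ
conv a b zero    = a 0 ⊗ b 0
conv a b (suc n) = conv (a ∘ suc) b n ⊕ conv a (b ∘ suc) n

conv-cong : ∀ {a a′ b b′ : ℕ → ℤ} → (∀ m → a m ≡ a′ m) → (∀ m → b m ≡ b′ m) →
            ∀ n → conv a b n ≡ conv a′ b′ n
conv-cong p q zero    = cong₂ _⊗_ (p 0) (q 0)
conv-cong p q (suc n) = cong₂ _⊕_ (conv-cong (p ∘ suc) q n) (conv-cong p (q ∘ suc) n)

conv-+ˡ : ∀ a b c n → conv (λ m → a m ⊕ b m) c n ≡ conv a c n ⊕ conv b c n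
conv-+ˡ a b c zero    = *-distribʳ-+ (c 0) (a 0) (b 0)
conv-+ˡ a b c (suc n) =
  trans (cong₂ _⊕_ (conv-+ˡ (a ∘ suc) (b ∘ suc) c n) (conv-+ˡ a b (c ∘ suc) n))
    (+-interchange (conv (a ∘ suc) c n) (conv (b ∘ suc) c n) (conv a (c ∘ suc) n) (conv b (c ∘ suc) n))

conv-+ʳ : ∀ a b c n → conv a (λ m → b m ⊕ c m) n ≡ conv a b n ⊕ conv a c n
conv-+ʳ a b c zero    = *-distribˡ-+ (a 0) (b 0) (c 0)
conv-+ʳ a b c (suc n) =
  trans (cong₂ _⊕_ (conv-+ʳ (a ∘ suc) b c n) (conv-+ʳ a (b ∘ suc) (c ∘ suc) n))
    (+-interchange (conv (a ∘ suc) b n) (conv (a ∘ suc) c n) (conv a (b ∘ suc) n) (conv a (c ∘ suc) n))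

conv-*ˡ : ∀ x a b n → conv (λ m → x ⊗ a m) b n ≡ x ⊗ conv a b n
conv-*ˡ x a b zero    = *-assoc x (a 0) (b 0)
conv-*ˡ x a b (suc n) =
  trans (cong₂ _⊕_ (conv-*ˡ x (a ∘ suc) b n) (conv-*ˡ x a (b ∘ suc) n)) (sym (*-distribˡ-+ x _ _))

conv-*ʳ : ∀ x a b n → conv a (λ m → x ⊗ b m) n ≡ x ⊗ conv a b n
conv-*ʳ x a b zero    = swap (a 0) x (b 0)
  where
  swap : ∀ a x b → a ⊗ (x ⊗ b) ≡ x ⊗ (a ⊗ b)
  swap = solve-∀
conv-*ʳ x a b (suc n) =
  trans (cong₂ _⊕_ (conv-*ʳ x (a ∘ suc) b n) (conv-*ʳ x a (b ∘ suc) n)) (sym (*-distribˡ-+ x _ _))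

conv-assoc : ∀ a b c n → conv (conv a b) c n ≡ conv a (conv b c) n
conv-assoc a b c zero    = *-assoc (a 0) (b 0) (c 0)
conv-assoc a b c (suc n) = begin
  conv (λ m → conv (a ∘ suc) b m ⊕ conv a (b ∘ suc) m) c n ⊕ conv (conv a b) (c ∘ suc) n
    ≡⟨ cong₂ _⊕_ (conv-+ˡ (conv (a ∘ suc) b) (conv a (b ∘ suc)) c n) (conv-assoc a b (c ∘ suc) n) ⟩
  (conv (conv (a ∘ suc) b) c n ⊕ conv (conv a (b ∘ suc)) c n) ⊕ conv a (conv b (c ∘ suc)) n
    ≡⟨ cong (_⊕ conv a (conv b (c ∘ suc)) n) (cong₂ _⊕_ (conv-assoc (a ∘ suc) b c n) (conv-assoc a (b ∘ suc) c n)) ⟩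
  (conv (a ∘ suc) (conv b c) n ⊕ conv a (conv (b ∘ suc) c) n) ⊕ conv a (conv b (c ∘ suc)) n
    ≡⟨ +-assoc (conv (a ∘ suc) (conv b c) n) (conv a (conv (b ∘ suc) c) n) (conv a (conv b (c ∘ suc)) n) ⟩
  conv (a ∘ suc) (conv b c) n ⊕ (conv a (conv (b ∘ suc) c) n ⊕ conv a (conv b (c ∘ suc)) n)
    ≡⟨ cong (conv (a ∘ suc) (conv b c) n ⊕_) (conv-+ʳ a (conv (b ∘ suc) c) (conv b (c ∘ suc)) n) ⟨
  conv (a ∘ suc) (conv b c) n ⊕ conv a (λ m → conv (b ∘ suc) c m ⊕ conv b (c ∘ suc) m) n ∎

-- The binomial theorem, in the form exp(xt) exp(yt) = exp((x + y)t).
conv-↑ : ∀ x y n → conv (x ↑_) (y ↑_) n ≡ (x ⊕ y) ↑ n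
conv-↑ x y zero    = refl
conv-↑ x y (suc n) = begin
  conv (λ m → x ⊗ x ↑ m) (y ↑_) n ⊕ conv (x ↑_) (λ m → y ⊗ y ↑ m) n
    ≡⟨ cong₂ _⊕_ (conv-*ˡ x (x ↑_) (y ↑_) n) (conv-*ʳ y (x ↑_) (y ↑_) n) ⟩
  x ⊗ conv (x ↑_) (y ↑_) n ⊕ y ⊗ conv (x ↑_) (y ↑_) n
    ≡⟨ *-distribʳ-+ _ x y ⟨
  (x ⊕ y) ⊗ conv (x ↑_) (y ↑_) n
    ≡⟨ cong ((x ⊕ y) ⊗_) (conv-↑ x y n) ⟩
  (x ⊕ y) ⊗ (x ⊕ y) ↑ n ∎

-- Connects the Leibniz recursion with the explicit sums in the definitions of `E` and `S`. Pascal's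
-- rule merges the two sums that the recursion produces.
conv-binomial : ∀ a b n → conv a b n ≡ Σ< (suc n) (λ k → + (n C k) ⊗ (a k ⊗ b (n ∸ k)))
conv-binomial a b zero    = trans (sym (*-identityˡ _)) (sym (+-identityˡ _))
conv-binomial a b (suc n) = begin
  conv (a ∘ suc) b n ⊕ conv a (b ∘ suc) n
    ≡⟨ cong₂ _⊕_ (conv-binomial (a ∘ suc) b n) (conv-binomial a (b ∘ suc) n) ⟩
  Σ< (suc n) f ⊕ Σ< (suc n) (λ k → + (n C k) ⊗ (a k ⊗ b (suc (n ∸ k))))
    ≡⟨ cong (Σ< (suc n) f ⊕_) (Σ<-cong (suc n) (λ { k (s≤s k≤n) → cong (λ i → + (n C k) ⊗ (a k ⊗ b i)) (sym (ℕ.+-∸-assoc 1 k≤n)) })) ⟩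
  Σ< (suc n) f ⊕ Σ< (suc n) g
    ≡⟨ cong (Σ< (suc n) f ⊕_) (+-identityʳ _) ⟨
  Σ< (suc n) f ⊕ (Σ< (suc n) g ⊕ 0ℤ)
    -- The index n + 1 adds nothing because `n C suc n` is 0. With it included, splitting off the
    -- first term leaves a sum of the same length as that of `f`.
    ≡⟨ cong (λ z → Σ< (suc n) f ⊕ (Σ< (suc n) g ⊕ z)) last≡0 ⟨
  Σ< (suc n) f ⊕ Σ< (suc (suc n)) g
    ≡⟨ cong (Σ< (suc n) f ⊕_) (Σ<-suc (suc n) g) ⟩
  Σ< (suc n) f ⊕ (g 0 ⊕ Σ< (suc n) (g ∘ suc))
    ≡⟨ rotate (Σ< (suc n) f) (g 0) (Σ< (suc n) (g ∘ suc)) ⟩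
  g 0 ⊕ (Σ< (suc n) f ⊕ Σ< (suc n) (g ∘ suc))
    ≡⟨ cong (g 0 ⊕_) (Σ<-+ (suc n) f (g ∘ suc)) ⟨
  g 0 ⊕ Σ< (suc n) (λ k → f k ⊕ g (suc k))
    ≡⟨ cong (g 0 ⊕_) (Σ<-cong (suc n) (λ k _ → pascal k)) ⟩
  g 0 ⊕ Σ< (suc n) (h ∘ suc)
    ≡⟨ Σ<-suc (suc n) h ⟨
  Σ< (suc (suc n)) h ∎
  where
  f g h : ℕ → ℤ
  f k = + (n C k) ⊗ (a (suc k) ⊗ b (n ∸ k))
  g k = + (n C k) ⊗ (a k ⊗ b (suc n ∸ k))
  h k = + (suc n C k) ⊗ (a k ⊗ b (suc n ∸ k))
  last≡0 : g (suc n) ≡ 0ℤ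
  last≡0 = cong (λ c → + c ⊗ (a (suc n) ⊗ b (n ∸ n))) (k>n⇒nCk≡0 (n<1+n n))
  rotate : ∀ x y z → x ⊕ (y ⊕ z) ≡ y ⊕ (x ⊕ z)
  rotate = solve-∀
  pascal : ∀ k → f k ⊕ g (suc k) ≡ h (suc k)
  pascal k = trans (sym (*-distribʳ-+ _ (+ (n C k)) (+ (n C suc k))))
    (cong (_⊗ (a (suc k) ⊗ b (n ∸ k))) (trans (sym (pos-+ (n C k) _)) (cong +_ (nCk+nC[k+1]≡[n+1]C[k+1] n k))))

-- Euler numbers and their Appell polynomials.

cosh : ℕ → ℤ
cosh m = if isEven m then 1ℤ else 0ℤ

1↑+-1↑≡2cosh : ∀ m → 1ℤ ↑ m ⊕ -1ℤ ↑ m ≡ + 2 ⊗ cosh m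
1↑+-1↑≡2cosh zero          = refl
1↑+-1↑≡2cosh (suc zero)    = refl
1↑+-1↑≡2cosh (suc (suc m)) = trans (two-steps (1ℤ ↑ m) (-1ℤ ↑ m)) (1↑+-1↑≡2cosh m)
  where
  two-steps : ∀ a b → 1ℤ ⊗ (1ℤ ⊗ a) ⊕ -1ℤ ⊗ (-1ℤ ⊗ b) ≡ a ⊕ b
  two-steps = solve-∀

sign≡-1↑ : ∀ m → (if isEven m then 1ℤ else - 1ℤ) ≡ -1ℤ ↑ m
sign≡-1↑ zero          = refl
sign≡-1↑ (suc zero)    = refl
sign≡-1↑ (suc (suc m)) = trans (sign≡-1↑ m) (two-steps (-1ℤ ↑ m))
  where
  two-steps : ∀ a → a ≡ -1ℤ ⊗ (-1ℤ ⊗ a)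
  two-steps = solve-∀

eulerTab-stable : ∀ n {k} → k ≤ n → eulerTab n k ≡ E k
eulerTab-stable zero    z≤n = refl
eulerTab-stable (suc n) {k} k≤1+n with m≤n⇒m<n∨m≡n k≤1+n
... | inj₂ refl      = refl
... | inj₁ (s≤s k≤n) = trans
  (cong (λ b → if b then eulerTab n k else eulerNext n (eulerTab n)) (dec-true (k ≤? n) k≤n))
  (eulerTab-stable n k≤n)

E-suc : ∀ n → E (suc n) ≡ eulerNext n (eulerTab n)
E-suc n = cong (λ b → if b then eulerTab n (suc n) else eulerNext n (eulerTab n))
               (dec-false (suc n ≤? n) (ℕ.<-irrefl refl))

-- The identity sech · cosh = 1, where `0ℤ ↑_` is the coefficient sequence of the constant 1. In
-- positive degree the top term of the convolution is `E (suc n)`, which the recursion defines as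
-- minus the sum of all the others.
conv-E-cosh : ∀ n → conv E cosh n ≡ 0ℤ ↑ n
conv-E-cosh zero    = refl
conv-E-cosh (suc n) = begin
  conv E cosh (suc n)
    ≡⟨ conv-binomial E cosh (suc n) ⟩
  Σ< (suc n) g ⊕ g (suc n)
    ≡⟨ cong₂ _⊕_ (sym (Σ<-cong (suc n) (λ { k (s≤s k≤n) → term k k≤n }))) last ⟩
  Σ< (suc n) f ⊕ E (suc n)
    ≡⟨ cong (Σ< (suc n) f ⊕_) (trans (E-suc n) (cong -_ (sumTo≡Σ< n f))) ⟩
  Σ< (suc n) f ⊖ Σ< (suc n) f
    ≡⟨ +-inverseʳ (Σ< (suc n) f) ⟩
  0ℤ
    ≡⟨ *-zeroˡ (0ℤ ↑ n) ⟨
  0ℤ ↑ suc n ∎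
  where
  f g : ℕ → ℤ
  f k = if isEven (suc n ∸ k) then + (suc n C k) ⊗ eulerTab n k else 0ℤ
  g k = + (suc n C k) ⊗ (E k ⊗ cosh (suc n ∸ k))
  if-* : ∀ b c e → (if b then c ⊗ e else 0ℤ) ≡ c ⊗ (e ⊗ (if b then 1ℤ else 0ℤ))
  if-* true  c e = cong (c ⊗_) (sym (*-identityʳ e))
  if-* false c e = sym (trans (cong (c ⊗_) (*-zeroʳ e)) (*-zeroʳ c))
  term : ∀ k → k ≤ n → f k ≡ g k
  term k k≤n rewrite eulerTab-stable n k≤n = if-* (isEven (suc n ∸ k)) (+ (suc n C k)) (E k)
  last : g (suc n) ≡ E (suc n)
  last rewrite nCn≡1 (suc n) | n∸n≡0 n = trans (*-identityˡ (E (suc n) ⊗ 1ℤ)) (*-identityʳ (E (suc n)))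

-- Here `conv E (z ↑_) r` is the Appell polynomial A_r(z), with generating function sech(t) exp(zt).
-- The left side has generating function sech(t) (exp(t) + exp(-t)) exp(yt) = 2 exp(yt).
conv-E-shift : ∀ y r → conv E ((1ℤ ⊕ y) ↑_) r ⊕ conv E ((-1ℤ ⊕ y) ↑_) r ≡ + 2 ⊗ y ↑ r
conv-E-shift y r = begin
  conv E ((1ℤ ⊕ y) ↑_) r ⊕ conv E ((-1ℤ ⊕ y) ↑_) r
    ≡⟨ cong₂ _⊕_ (unfold 1ℤ) (unfold -1ℤ) ⟩
  conv (conv E (1ℤ ↑_)) (y ↑_) r ⊕ conv (conv E (-1ℤ ↑_)) (y ↑_) r
    ≡⟨ conv-+ˡ (conv E (1ℤ ↑_)) (conv E (-1ℤ ↑_)) (y ↑_) r ⟨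
  conv (λ m → conv E (1ℤ ↑_) m ⊕ conv E (-1ℤ ↑_) m) (y ↑_) r
    ≡⟨ conv-cong sech·cosh (λ _ → refl) r ⟩
  conv (λ m → + 2 ⊗ 0ℤ ↑ m) (y ↑_) r
    ≡⟨ conv-*ˡ (+ 2) (0ℤ ↑_) (y ↑_) r ⟩
  + 2 ⊗ conv (0ℤ ↑_) (y ↑_) r
    ≡⟨ cong (+ 2 ⊗_) (trans (conv-↑ 0ℤ y r) (cong (_↑ r) (+-identityˡ y))) ⟩
  + 2 ⊗ y ↑ r ∎
  where
  unfold : ∀ x → conv E ((x ⊕ y) ↑_) r ≡ conv (conv E (x ↑_)) (y ↑_) r
  unfold x = trans (conv-cong (λ _ → refl) (λ m → sym (conv-↑ x y m)) r)
                   (sym (conv-assoc E (x ↑_) (y ↑_) r))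
  sech·cosh : ∀ m → conv E (1ℤ ↑_) m ⊕ conv E (-1ℤ ↑_) m ≡ + 2 ⊗ 0ℤ ↑ m
  sech·cosh m = begin
    conv E (1ℤ ↑_) m ⊕ conv E (-1ℤ ↑_) m       ≡⟨ conv-+ʳ E (1ℤ ↑_) (-1ℤ ↑_) m ⟨
    conv E (λ i → 1ℤ ↑ i ⊕ -1ℤ ↑ i) m          ≡⟨ conv-cong (λ _ → refl) 1↑+-1↑≡2cosh m ⟩
    conv E (λ i → + 2 ⊗ cosh i) m              ≡⟨ conv-*ʳ (+ 2) E cosh m ⟩
    + 2 ⊗ conv E cosh m                        ≡⟨ cong (+ 2 ⊗_) (conv-E-cosh m) ⟩
    + 2 ⊗ 0ℤ ↑ m                               ∎

conv-↑-mod : ∀ a y n → ∃ λ q → conv a (y ↑_) n ≡ a n ⊕ y ⊗ q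
conv-↑-mod a y zero    = 0ℤ , base (a 0) y
  where
  base : ∀ a y → a ⊗ 1ℤ ≡ a ⊕ y ⊗ 0ℤ
  base = solve-∀
conv-↑-mod a y (suc n) with q , eq ← conv-↑-mod (a ∘ suc) y n =
  q ⊕ conv a (y ↑_) n ,
  trans (cong₂ _⊕_ eq (conv-*ʳ y a (y ↑_) n)) (collect (a (suc n)) y q (conv a (y ↑_) n))
  where
  collect : ∀ a y q c → (a ⊕ y ⊗ q) ⊕ y ⊗ c ≡ a ⊕ y ⊗ (q ⊕ c)
  collect = solve-∀

-- Second-order expansion at 0, using that the derivative of an Appell polynomial of degree n + 1 is
-- n + 1 times the preceding one. For `a` = `E` the linear coefficient is `F (suc n)`, which is how
-- `F` enters.
conv-↑-mod² : ∀ a y n → ∃ λ q →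
              conv a (y ↑_) (suc n) ≡ a (suc n) ⊕ y ⊗ (+ suc n ⊗ a n) ⊕ (y ⊗ y) ⊗ q
conv-↑-mod² a y zero    = 0ℤ , base (a 0) (a 1) y
  where
  base : ∀ a b y → b ⊗ 1ℤ ⊕ a ⊗ (y ⊗ 1ℤ) ≡ b ⊕ y ⊗ (1ℤ ⊗ a) ⊕ (y ⊗ y) ⊗ 0ℤ
  base = solve-∀
conv-↑-mod² a y (suc n)
  with q , eq ← conv-↑-mod² (a ∘ suc) y n | r , eq′ ← conv-↑-mod a y (suc n) =
  q ⊕ r ,
  trans (cong₂ _⊕_ eq (trans (conv-*ʳ y a (y ↑_) (suc n)) (cong (y ⊗_) eq′)))
        (collect (a (suc (suc n))) (a (suc n)) y (+ suc n) q r)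
  where
  collect : ∀ a b y s q r → (a ⊕ y ⊗ (s ⊗ b) ⊕ (y ⊗ y) ⊗ q) ⊕ y ⊗ (b ⊕ y ⊗ r)
                          ≡ a ⊕ y ⊗ ((1ℤ ⊕ s) ⊗ b) ⊕ (y ⊗ y) ⊗ (q ⊕ r)
  collect = solve-∀

-- The shift identity at y + 3 minus the one at y + 1: the value at y + 2 cancels.
conv-E-shift₄ : ∀ y r → conv E ((+ 4 ⊕ y) ↑_) r
                      ≡ conv E (y ↑_) r ⊕ + 2 ⊗ ((+ 3 ⊕ y) ↑ r ⊖ (+ 1 ⊕ y) ↑ r)
conv-E-shift₄ y r = begin
  A (+ 4 ⊕ y)
    ≡⟨ telescope (A (+ 4 ⊕ y)) (A (+ 2 ⊕ y)) (A y) ⟩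
  A y ⊕ ((A (+ 4 ⊕ y) ⊕ A (+ 2 ⊕ y)) ⊖ (A (+ 2 ⊕ y) ⊕ A y))
    ≡⟨ cong (A y ⊕_) (cong₂ _⊖_ (trans (cong₂ _⊕_ (cong A (e₄ y)) (cong A (e₂ y))) (conv-E-shift (+ 3 ⊕ y) r))
                                (trans (cong₂ _⊕_ (cong A (e₂′ y)) (cong A (e₀ y))) (conv-E-shift (+ 1 ⊕ y) r))) ⟩
  A y ⊕ (+ 2 ⊗ (+ 3 ⊕ y) ↑ r ⊖ + 2 ⊗ (+ 1 ⊕ y) ↑ r)
    ≡⟨ cong (A y ⊕_) (factor ((+ 3 ⊕ y) ↑ r) ((+ 1 ⊕ y) ↑ r)) ⟩
  A y ⊕ + 2 ⊗ ((+ 3 ⊕ y) ↑ r ⊖ (+ 1 ⊕ y) ↑ r) ∎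
  where
  A : ℤ → ℤ
  A z = conv E (z ↑_) r
  telescope : ∀ a b c → a ≡ c ⊕ ((a ⊕ b) ⊖ (b ⊕ c))
  telescope = solve-∀
  factor : ∀ a b → + 2 ⊗ a ⊖ + 2 ⊗ b ≡ + 2 ⊗ (a ⊖ b)
  factor = solve-∀
  e₄ : ∀ y → + 4 ⊕ y ≡ 1ℤ ⊕ (+ 3 ⊕ y)
  e₄ = solve-∀
  e₂ : ∀ y → + 2 ⊕ y ≡ -1ℤ ⊕ (+ 3 ⊕ y)
  e₂ = solve-∀
  e₂′ : ∀ y → + 2 ⊕ y ≡ 1ℤ ⊕ (+ 1 ⊕ y)
  e₂′ = solve-∀
  e₀ : ∀ y → y ≡ -1ℤ ⊕ (+ 1 ⊕ y)
  e₀ = solve-∀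

conv-E-4N : ∀ N r → conv E ((+ 4 ⊗ + N) ↑_) r
  ≡ E r ⊕ + 2 ⊗ Σ< N (λ k → (+ 3 ⊕ + 4 ⊗ + k) ↑ r ⊖ (+ 1 ⊕ + 4 ⊗ + k) ↑ r)
conv-E-4N zero    r = trans (proj₂ (conv-↑-mod E 0ℤ r)) (cong (E r ⊕_) (*-zeroˡ (proj₁ (conv-↑-mod E 0ℤ r))))
conv-E-4N (suc N) r = begin
  conv E ((+ 4 ⊗ + suc N) ↑_) r
    ≡⟨ cong (λ z → conv E (z ↑_) r) (4[1+n] (+ N)) ⟩
  conv E ((+ 4 ⊕ + 4 ⊗ + N) ↑_) r
    ≡⟨ conv-E-shift₄ (+ 4 ⊗ + N) r ⟩
  conv E ((+ 4 ⊗ + N) ↑_) r ⊕ + 2 ⊗ d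
    ≡⟨ cong (_⊕ + 2 ⊗ d) (conv-E-4N N r) ⟩
  (E r ⊕ + 2 ⊗ s) ⊕ + 2 ⊗ d
    ≡⟨ collect (E r) s d ⟩
  E r ⊕ + 2 ⊗ (s ⊕ d) ∎
  where
  s d : ℤ
  s = Σ< N (λ k → (+ 3 ⊕ + 4 ⊗ + k) ↑ r ⊖ (+ 1 ⊕ + 4 ⊗ + k) ↑ r)
  d = (+ 3 ⊕ + 4 ⊗ + N) ↑ r ⊖ (+ 1 ⊕ + 4 ⊗ + N) ↑ r
  4[1+n] : ∀ n → + 4 ⊗ (1ℤ ⊕ n) ≡ + 4 ⊕ + 4 ⊗ n
  4[1+n] = solve-∀
  collect : ∀ e s d → (e ⊕ + 2 ⊗ s) ⊕ + 2 ⊗ d ≡ e ⊕ + 2 ⊗ (s ⊕ d)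
  collect = solve-∀

-- Comparing the sum `S` with power sums over odd integers.

u : ℕ → ℕ → ℤ → ℤ
u j n x = x ↑ j ⊗ (x ⊗ x ⊖ 1ℤ) ↑ n

U : ℕ → ℕ → ℕ → ℤ
U N j n = Σ< N (λ k → u j n (+ 3 ⊕ + 4 ⊗ + k) ⊖ u j n (+ 1 ⊕ + 4 ⊗ + k))

-- A_j(4N) is computed twice, by telescoping and by the second-order expansion; cancelling `E j` and
-- a factor 2 leaves the claim. For j = 0 both `U` and `F` vanish.
U-zero-mod : ∀ N j → ∃ λ q → U N j 0 ≡ + 2 ⊗ + N ⊗ F j ⊕ + 8 ⊗ (+ N ⊗ + N) ⊗ q
U-zero-mod N zero    = 0ℤ , trans (Σ<-*ˡ N 0ℤ (λ _ → 0ℤ)) (zeros (+ N))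
  where
  zeros : ∀ n → 0ℤ ≡ + 2 ⊗ n ⊗ 0ℤ ⊕ + 8 ⊗ (n ⊗ n) ⊗ 0ℤ
  zeros = solve-∀
U-zero-mod N (suc r) with q , eq ← conv-↑-mod² E (+ 4 ⊗ + N) r = q ,
  *-cancelˡ-≡ (+ 2) _ _ (begin
  + 2 ⊗ U N (suc r) 0
    ≡⟨ cong (+ 2 ⊗_) (Σ<-cong N (λ k _ → cong₂ _⊖_ (*-identityʳ ((+ 3 ⊕ + 4 ⊗ + k) ↑ suc r))
                                                   (*-identityʳ ((+ 1 ⊕ + 4 ⊗ + k) ↑ suc r)))) ⟩
  + 2 ⊗ J
    ≡⟨ cancel-E (E (suc r)) J ⟩
  (E (suc r) ⊕ + 2 ⊗ J) ⊖ E (suc r)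
    ≡⟨ cong (_⊖ E (suc r)) (trans (sym (conv-E-4N N (suc r))) eq) ⟩
  (E (suc r) ⊕ (+ 4 ⊗ + N) ⊗ F (suc r) ⊕ ((+ 4 ⊗ + N) ⊗ (+ 4 ⊗ + N)) ⊗ q) ⊖ E (suc r)
    ≡⟨ expand (E (suc r)) (+ N) (F (suc r)) q ⟩
  + 2 ⊗ (+ 2 ⊗ + N ⊗ F (suc r) ⊕ + 8 ⊗ (+ N ⊗ + N) ⊗ q) ∎)
  where
  J : ℤ
  J = Σ< N (λ k → (+ 3 ⊕ + 4 ⊗ + k) ↑ suc r ⊖ (+ 1 ⊕ + 4 ⊗ + k) ↑ suc r)
  cancel-E : ∀ e s → + 2 ⊗ s ≡ (e ⊕ + 2 ⊗ s) ⊖ e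
  cancel-E = solve-∀
  expand : ∀ e n f q → (e ⊕ (+ 4 ⊗ n) ⊗ f ⊕ ((+ 4 ⊗ n) ⊗ (+ 4 ⊗ n)) ⊗ q) ⊖ e
                     ≡ + 2 ⊗ (+ 2 ⊗ n ⊗ f ⊕ + 8 ⊗ (n ⊗ n) ⊗ q)
  expand = solve-∀

-- One factor x² - 1 is multiplied out. `S-suc` is the same recursion for `S`.
U-suc : ∀ N j n → U N j (suc n) ≡ U N (2 + j) n ⊖ U N j n
U-suc zero    j n = refl
U-suc (suc N) j n = trans (cong₂ _⊕_ (U-suc N j n) (cong₂ _⊖_ (u-suc x₃) (u-suc x₁)))
  (rearrange (U N (2 + j) n) (U N j n) (u (2 + j) n x₃) (u j n x₃) (u (2 + j) n x₁) (u j n x₁))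
  where
  x₁ x₃ : ℤ
  x₁ = + 1 ⊕ + 4 ⊗ + N
  x₃ = + 3 ⊕ + 4 ⊗ + N
  u-suc : ∀ x → u j (suc n) x ≡ u (2 + j) n x ⊖ u j n x
  u-suc x = expand x (x ↑ j) ((x ⊗ x ⊖ 1ℤ) ↑ n)
    where
    expand : ∀ x p w → p ⊗ ((x ⊗ x ⊖ 1ℤ) ⊗ w) ≡ (x ⊗ (x ⊗ p)) ⊗ w ⊖ p ⊗ w
    expand = solve-∀
  rearrange : ∀ a b c d e f → (a ⊖ b) ⊕ ((c ⊖ d) ⊖ (e ⊖ f)) ≡ (a ⊕ (c ⊖ e)) ⊖ (b ⊕ (d ⊖ f))
  rearrange = solve-∀

S≡conv : ∀ j n → S j n ≡ conv (λ i → F (2 * i + j)) (-1ℤ ↑_) n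
S≡conv j n = begin
  S j n
    ≡⟨ sumTo≡Σ< n _ ⟩
  Σ< (suc n) (λ i → (if isEven (n ∸ i) then 1ℤ else - 1ℤ) ⊗ (+ (n C i) ⊗ F (2 * i + j)))
    ≡⟨ Σ<-cong (suc n) (λ i _ → trans (cong (_⊗ (+ (n C i) ⊗ F (2 * i + j))) (sign≡-1↑ (n ∸ i)))
                                      (rotate (-1ℤ ↑ (n ∸ i)) (+ (n C i)) (F (2 * i + j)))) ⟩
  Σ< (suc n) (λ i → + (n C i) ⊗ (F (2 * i + j) ⊗ -1ℤ ↑ (n ∸ i)))
    ≡⟨ conv-binomial (λ i → F (2 * i + j)) (-1ℤ ↑_) n ⟨
  conv (λ i → F (2 * i + j)) (-1ℤ ↑_) n ∎
  where
  rotate : ∀ s c f → s ⊗ (c ⊗ f) ≡ c ⊗ (f ⊗ s)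
  rotate = solve-∀

S-zero : ∀ j → S j 0 ≡ F j
S-zero j = trans (S≡conv j 0) (*-identityʳ (F j))

-- The Leibniz step of the convolution: advancing i by one raises the index of `F` by 2, and
-- advancing the power of -1 changes the sign.
S-suc : ∀ j n → S j (suc n) ≡ S (2 + j) n ⊖ S j n
S-suc j n = begin
  S j (suc n)
    ≡⟨ S≡conv j (suc n) ⟩
  conv (λ i → F (2 * suc i + j)) (-1ℤ ↑_) n ⊕ conv f (λ m → -1ℤ ⊗ -1ℤ ↑ m) n
    ≡⟨ cong₂ _⊕_ (conv-cong (λ i → cong F (index i)) (λ _ → refl) n) (conv-*ʳ -1ℤ f (-1ℤ ↑_) n) ⟩
  conv (λ i → F (2 * i + (2 + j))) (-1ℤ ↑_) n ⊕ -1ℤ ⊗ conv f (-1ℤ ↑_) n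
    ≡⟨ cong₂ (λ a b → a ⊕ -1ℤ ⊗ b) (sym (S≡conv (2 + j) n)) (sym (S≡conv j n)) ⟩
  S (2 + j) n ⊕ -1ℤ ⊗ S j n
    ≡⟨ neg (S (2 + j) n) (S j n) ⟩
  S (2 + j) n ⊖ S j n ∎
  where
  f : ℕ → ℤ
  f i = F (2 * i + j)
  index : ∀ i → 2 * suc i + j ≡ 2 * i + (2 + j)
  index i = trans (cong (_+ j) (ℕ.*-suc 2 i)) (trans (cong (_+ j) (ℕ.+-comm 2 (2 * i))) (ℕ.+-assoc (2 * i) 2 j))
  neg : ∀ a b → a ⊕ -1ℤ ⊗ b ≡ a ⊖ b
  neg = solve-∀

-- `U` and `S` satisfy the same linear recursion in n, so the congruence propagates from n = 0 to
-- all n, for all j at once.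
U-mod : ∀ N j n → ∃ λ q → U N j n ≡ + 2 ⊗ + N ⊗ S j n ⊕ + 8 ⊗ (+ N ⊗ + N) ⊗ q
U-mod N j zero with q , eq ← U-zero-mod N j =
  q , trans eq (cong (λ z → + 2 ⊗ + N ⊗ z ⊕ + 8 ⊗ (+ N ⊗ + N) ⊗ q) (sym (S-zero j)))
U-mod N j (suc n) with q , eq ← U-mod N (2 + j) n | r , eq′ ← U-mod N j n = q ⊖ r , (begin
  U N j (suc n)
    ≡⟨ U-suc N j n ⟩
  U N (2 + j) n ⊖ U N j n
    ≡⟨ cong₂ _⊖_ eq eq′ ⟩
  (+ 2 ⊗ + N ⊗ S (2 + j) n ⊕ + 8 ⊗ (+ N ⊗ + N) ⊗ q) ⊖ (+ 2 ⊗ + N ⊗ S j n ⊕ + 8 ⊗ (+ N ⊗ + N) ⊗ r)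
    ≡⟨ collect (+ N) (S (2 + j) n) (S j n) q r ⟩
  + 2 ⊗ + N ⊗ (S (2 + j) n ⊖ S j n) ⊕ + 8 ⊗ (+ N ⊗ + N) ⊗ (q ⊖ r)
    ≡⟨ cong (λ z → + 2 ⊗ + N ⊗ z ⊕ + 8 ⊗ (+ N ⊗ + N) ⊗ (q ⊖ r)) (S-suc j n) ⟨
  + 2 ⊗ + N ⊗ S j (suc n) ⊕ + 8 ⊗ (+ N ⊗ + N) ⊗ (q ⊖ r) ∎)
  where
  collect : ∀ n a b q r → (+ 2 ⊗ n ⊗ a ⊕ + 8 ⊗ (n ⊗ n) ⊗ q) ⊖ (+ 2 ⊗ n ⊗ b ⊕ + 8 ⊗ (n ⊗ n) ⊗ r)
                        ≡ + 2 ⊗ n ⊗ (a ⊖ b) ⊕ + 8 ⊗ (n ⊗ n) ⊗ (q ⊖ r)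
  collect = solve-∀

-- Sums of polynomial values over ranges of length 2^s.

-- Polynomials are kept as expressions, so that derivatives and Taylor remainders can be found by
-- structural recursion.
data Poly : Set where
  var     : Poly
  con     : ℤ → Poly
  _⊞_ _⊠_ : Poly → Poly → Poly

infixl 6 _⊞_
infixl 7 _⊠_

eval : Poly → ℤ → ℤ
eval var     x = x
eval (con c) x = c
eval (p ⊞ q) x = eval p x ⊕ eval q x
eval (p ⊠ q) x = eval p x ⊗ eval q x

deriv : Poly → Poly
deriv var     = con 1ℤ
deriv (con c) = con 0ℤ
deriv (p ⊞ q) = deriv p ⊞ deriv q
deriv (p ⊠ q) = deriv p ⊠ q ⊞ p ⊠ deriv q

_^ᴾ_ : Poly → ℕ → Poly
p ^ᴾ zero  = con 1ℤ
p ^ᴾ suc n = p ⊠ p ^ᴾ n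

infixr 8 _^ᴾ_

eval-^ᴾ : ∀ p n x → eval (p ^ᴾ n) x ≡ eval p x ↑ n
eval-^ᴾ p zero    x = refl
eval-^ᴾ p (suc n) x = cong (eval p x ⊗_) (eval-^ᴾ p n x)

-- Induction on the expression gives an integral remainder directly, with no division of the second
-- derivative by 2.
taylor : ∀ p x h → ∃ λ q → eval p (x ⊕ h) ≡ eval p x ⊕ h ⊗ eval (deriv p) x ⊕ (h ⊗ h) ⊗ q
taylor var     x h = 0ℤ , base x h
  where
  base : ∀ x h → x ⊕ h ≡ x ⊕ h ⊗ 1ℤ ⊕ (h ⊗ h) ⊗ 0ℤ
  base = solve-∀
taylor (con c) x h = 0ℤ , base c h
  where
  base : ∀ c h → c ≡ c ⊕ h ⊗ 0ℤ ⊕ (h ⊗ h) ⊗ 0ℤ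
  base = solve-∀
taylor (p ⊞ p′) x h with q , eq ← taylor p x h | q′ , eq′ ← taylor p′ x h =
  q ⊕ q′ , trans (cong₂ _⊕_ eq eq′)
                 (collect (eval p x) (eval (deriv p) x) (eval p′ x) (eval (deriv p′) x) h q q′)
  where
  collect : ∀ a a′ b b′ h q r → (a ⊕ h ⊗ a′ ⊕ (h ⊗ h) ⊗ q) ⊕ (b ⊕ h ⊗ b′ ⊕ (h ⊗ h) ⊗ r)
                              ≡ (a ⊕ b) ⊕ h ⊗ (a′ ⊕ b′) ⊕ (h ⊗ h) ⊗ (q ⊕ r)
  collect = solve-∀
taylor (p ⊠ p′) x h with q , eq ← taylor p x h | q′ , eq′ ← taylor p′ x h =
  a ⊗ q′ ⊕ a′ ⊗ b′ ⊕ h ⊗ a′ ⊗ q′ ⊕ q ⊗ b ⊕ h ⊗ q ⊗ b′ ⊕ (h ⊗ h) ⊗ (q ⊗ q′) ,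
  trans (cong₂ _⊗_ eq eq′) (collect a a′ b b′ h q q′)
  where
  a a′ b b′ : ℤ
  a  = eval p x
  a′ = eval (deriv p) x
  b  = eval p′ x
  b′ = eval (deriv p′) x
  collect : ∀ a a′ b b′ h q r → (a ⊕ h ⊗ a′ ⊕ (h ⊗ h) ⊗ q) ⊗ (b ⊕ h ⊗ b′ ⊕ (h ⊗ h) ⊗ r)
          ≡ a ⊗ b ⊕ h ⊗ (a′ ⊗ b ⊕ a ⊗ b′)
            ⊕ (h ⊗ h) ⊗ (a ⊗ r ⊕ a′ ⊗ b′ ⊕ h ⊗ a′ ⊗ r ⊕ q ⊗ b ⊕ h ⊗ q ⊗ b′ ⊕ (h ⊗ h) ⊗ (q ⊗ r))
  collect = solve-∀

ΣP : ℕ → Poly → ℤ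
ΣP N p = Σ< N (λ k → eval p (+ k))

ΣP-shift : ∀ M h p → ∃ λ q →
  Σ< M (λ k → eval p (+ k ⊕ h)) ≡ ΣP M p ⊕ h ⊗ ΣP M (deriv p) ⊕ (h ⊗ h) ⊗ q
ΣP-shift zero    h p = 0ℤ , base h
  where
  base : ∀ h → 0ℤ ≡ 0ℤ ⊕ h ⊗ 0ℤ ⊕ (h ⊗ h) ⊗ 0ℤ
  base = solve-∀
ΣP-shift (suc M) h p with q , eq ← ΣP-shift M h p | r , eq′ ← taylor p (+ M) h =
  q ⊕ r , trans (cong₂ _⊕_ eq eq′)
                (collect (ΣP M p) (ΣP M (deriv p)) (eval p (+ M)) (eval (deriv p) (+ M)) h q r)
  where
  collect : ∀ a a′ b b′ h q r → (a ⊕ h ⊗ a′ ⊕ (h ⊗ h) ⊗ q) ⊕ (b ⊕ h ⊗ b′ ⊕ (h ⊗ h) ⊗ r)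
                              ≡ (a ⊕ b) ⊕ h ⊗ (a′ ⊕ b′) ⊕ (h ⊗ h) ⊗ (q ⊕ r)
  collect = solve-∀

2^ : ℕ → ℤ
2^ s = + (2 ^ s)

2^-suc : ∀ s → 2^ (suc s) ≡ + 2 ⊗ 2^ s
2^-suc s = pos-* 2 (2 ^ s)

2^-+ : ∀ s t → 2^ (s + t) ≡ 2^ s ⊗ 2^ t
2^-+ s t = trans (cong +_ (ℕ.^-distribˡ-+-* 2 s t)) (pos-* (2 ^ s) (2 ^ t))

-- The upper half of the range is the lower half shifted by 2^s.
ΣP-double : ∀ s p → ∃ λ q →
  ΣP (2 ^ suc s) p ≡ + 2 ⊗ ΣP (2 ^ s) p ⊕ 2^ s ⊗ ΣP (2 ^ s) (deriv p) ⊕ (2^ s ⊗ 2^ s) ⊗ q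
ΣP-double s p with q , eq ← ΣP-shift (2 ^ s) (2^ s) p = q , (begin
  ΣP (2 ^ suc s) p
    ≡⟨ cong (λ z → ΣP (2 ^ s + z) p) (ℕ.+-identityʳ (2 ^ s)) ⟩
  ΣP (2 ^ s + 2 ^ s) p
    ≡⟨ Σ<-split (2 ^ s) (2 ^ s) (λ k → eval p (+ k)) ⟩
  ΣP (2 ^ s) p ⊕ Σ< (2 ^ s) (λ k → eval p (+ (2 ^ s + k)))
    ≡⟨ cong (ΣP (2 ^ s) p ⊕_) (Σ<-cong (2 ^ s) (λ k _ → cong (eval p) (cong +_ (ℕ.+-comm (2 ^ s) k)))) ⟩
  ΣP (2 ^ s) p ⊕ Σ< (2 ^ s) (λ k → eval p (+ k ⊕ 2^ s))
    ≡⟨ cong (ΣP (2 ^ s) p ⊕_) eq ⟩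
  ΣP (2 ^ s) p ⊕ (ΣP (2 ^ s) p ⊕ 2^ s ⊗ ΣP (2 ^ s) (deriv p) ⊕ (2^ s ⊗ 2^ s) ⊗ q)
    ≡⟨ collect (ΣP (2 ^ s) p) (2^ s) (ΣP (2 ^ s) (deriv p)) q ⟩
  + 2 ⊗ ΣP (2 ^ s) p ⊕ 2^ s ⊗ ΣP (2 ^ s) (deriv p) ⊕ (2^ s ⊗ 2^ s) ⊗ q ∎)
  where
  collect : ∀ a h b q → a ⊕ (a ⊕ h ⊗ b ⊕ (h ⊗ h) ⊗ q) ≡ + 2 ⊗ a ⊕ h ⊗ b ⊕ (h ⊗ h) ⊗ q
  collect = solve-∀

-- By induction every term of `ΣP-double` is a multiple of 2^s, and the outer factor 2 supplies the
-- next power. That factor cannot be dropped: the sum of all k < 2^s is an odd multiple of 2^(s-1)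
-- for s ≥ 1.
2ΣP-mod : ∀ s p → ∃ λ q → + 2 ⊗ ΣP (2 ^ s) p ≡ 2^ s ⊗ q
2ΣP-mod zero    p = + 2 ⊗ ΣP 1 p , sym (*-identityˡ (+ 2 ⊗ ΣP 1 p))
2ΣP-mod (suc s) p with q , eq ← ΣP-double s p | r , eq′ ← 2ΣP-mod s p =
  r ⊕ ΣP (2 ^ s) (deriv p) ⊕ 2^ s ⊗ q , (begin
  + 2 ⊗ ΣP (2 ^ suc s) p
    ≡⟨ cong (+ 2 ⊗_) eq ⟩
  + 2 ⊗ (+ 2 ⊗ ΣP (2 ^ s) p ⊕ 2^ s ⊗ ΣP (2 ^ s) (deriv p) ⊕ (2^ s ⊗ 2^ s) ⊗ q)
    ≡⟨ cong (λ z → + 2 ⊗ (z ⊕ 2^ s ⊗ ΣP (2 ^ s) (deriv p) ⊕ (2^ s ⊗ 2^ s) ⊗ q)) eq′ ⟩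
  + 2 ⊗ (2^ s ⊗ r ⊕ 2^ s ⊗ ΣP (2 ^ s) (deriv p) ⊕ (2^ s ⊗ 2^ s) ⊗ q)
    ≡⟨ collect (2^ s) r (ΣP (2 ^ s) (deriv p)) q ⟩
  (+ 2 ⊗ 2^ s) ⊗ (r ⊕ ΣP (2 ^ s) (deriv p) ⊕ 2^ s ⊗ q)
    ≡⟨ cong (_⊗ (r ⊕ ΣP (2 ^ s) (deriv p) ⊕ 2^ s ⊗ q)) (2^-suc s) ⟨
  2^ (suc s) ⊗ (r ⊕ ΣP (2 ^ s) (deriv p) ⊕ 2^ s ⊗ q) ∎)
  where
  collect : ∀ h r b q → + 2 ⊗ (h ⊗ r ⊕ h ⊗ b ⊕ (h ⊗ h) ⊗ q) ≡ (+ 2 ⊗ h) ⊗ (r ⊕ b ⊕ h ⊗ q)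
  collect = solve-∀

-- In general ΣP (2 ^ suc s) p ≡ 2 ΣP (2 ^ s) p modulo 2^(2s−1), so 2^(-s) ΣP (2 ^ s) p
-- is determined modulo 4 by its value at s = 4.
ΣP-16-mod : ∀ k p → ∃ λ q → ΣP (2 ^ (4 + k)) p ≡ 2^ k ⊗ (ΣP 16 p ⊕ + 64 ⊗ q)
ΣP-16-mod zero    p = 0ℤ , base (ΣP 16 p)
  where
  base : ∀ a → a ≡ 1ℤ ⊗ (a ⊕ + 64 ⊗ 0ℤ)
  base = solve-∀
ΣP-16-mod (suc k) p =
  let q , eq  = ΣP-16-mod k p
      r , eq′ = ΣP-double (4 + k) p
      t , eq″ = 2ΣP-mod (4 + k) (deriv p)
  in q ⊕ 2^ k ⊗ (t ⊕ + 2 ⊗ r) ,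
     trans (combine (2^ k) (2^ (4 + k)) (ΣP 16 p) (ΣP (2 ^ (4 + k)) p) (ΣP (2 ^ (5 + k)) p)
                    (ΣP (2 ^ (4 + k)) (deriv p)) q r t (2^-+ 4 k) eq eq′ eq″)
           (cong (_⊗ (ΣP 16 p ⊕ + 64 ⊗ (q ⊕ 2^ k ⊗ (t ⊕ + 2 ⊗ r)))) (sym (2^-suc k)))
  where
  combine : ∀ K H A X Y B q r t → H ≡ + 16 ⊗ K → X ≡ K ⊗ (A ⊕ + 64 ⊗ q) →
            Y ≡ + 2 ⊗ X ⊕ H ⊗ B ⊕ (H ⊗ H) ⊗ r → + 2 ⊗ B ≡ H ⊗ t →
            Y ≡ (+ 2 ⊗ K) ⊗ (A ⊕ + 64 ⊗ (q ⊕ K ⊗ (t ⊕ + 2 ⊗ r)))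
  combine K H A X Y B q r t refl refl refl 2B≡Ht =
    -- Only `+ 2 ⊗ B` is known to be divisible by H, so 16K · B is regrouped as 8K · 2B = 128K² · t,
    -- a multiple of 2K · 64.
    trans (group K A q B r)
    (trans (cong (λ z → + 2 ⊗ (K ⊗ (A ⊕ + 64 ⊗ q)) ⊕ (+ 8 ⊗ K) ⊗ z ⊕ ((+ 16 ⊗ K) ⊗ (+ 16 ⊗ K)) ⊗ r) 2B≡Ht)
           (collect K A q t r))
    where
    group : ∀ K A q B r →
      + 2 ⊗ (K ⊗ (A ⊕ + 64 ⊗ q)) ⊕ (+ 16 ⊗ K) ⊗ B ⊕ ((+ 16 ⊗ K) ⊗ (+ 16 ⊗ K)) ⊗ r
      ≡ + 2 ⊗ (K ⊗ (A ⊕ + 64 ⊗ q)) ⊕ (+ 8 ⊗ K) ⊗ (+ 2 ⊗ B) ⊕ ((+ 16 ⊗ K) ⊗ (+ 16 ⊗ K)) ⊗ r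
    group = solve-∀
    collect : ∀ K A q t r →
      + 2 ⊗ (K ⊗ (A ⊕ + 64 ⊗ q)) ⊕ (+ 8 ⊗ K) ⊗ ((+ 16 ⊗ K) ⊗ t) ⊕ ((+ 16 ⊗ K) ⊗ (+ 16 ⊗ K)) ⊗ r
      ≡ (+ 2 ⊗ K) ⊗ (A ⊕ + 64 ⊗ (q ⊕ K ⊗ (t ⊕ + 2 ⊗ r)))
    collect = solve-∀

-- Extracting the factor 8^n.

-- `t₁` and `t₃` are (x² - 1)/8 at x = 4k + 1 and x = 4k + 3: the triangular numbers of index 2k and
-- 2k + 1.
x₁ x₃ t₁ t₃ : Poly
x₁ = con (+ 1) ⊞ con (+ 4) ⊠ var
x₃ = con (+ 3) ⊞ con (+ 4) ⊠ var
t₁ = var ⊠ (con (+ 2) ⊠ var ⊞ con 1ℤ)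
t₃ = (var ⊞ con 1ℤ) ⊠ (con (+ 2) ⊠ var ⊞ con 1ℤ)

P : ℕ → ℕ → Poly
P j n = x₃ ^ᴾ j ⊠ t₃ ^ᴾ n ⊞ con -1ℤ ⊠ (x₁ ^ᴾ j ⊠ t₁ ^ᴾ n)

u≡8^*eval : ∀ x t → (∀ y → eval x y ⊗ eval x y ⊖ 1ℤ ≡ + 8 ⊗ eval t y) →
            ∀ j n y → u j n (eval x y) ≡ 2^ (3 * n) ⊗ eval (x ^ᴾ j ⊠ t ^ᴾ n) y
u≡8^*eval x t x²≡8t+1 j zero    y =
  trans (*-identityʳ (eval x y ↑ j))
  (trans (sym (eval-^ᴾ x j y))
  (trans (sym (*-identityʳ (eval (x ^ᴾ j) y)))
         (sym (*-identityˡ (eval (x ^ᴾ j) y ⊗ 1ℤ)))))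
u≡8^*eval x t x²≡8t+1 j (suc n) y = begin
  X ↑ j ⊗ ((X ⊗ X ⊖ 1ℤ) ⊗ (X ⊗ X ⊖ 1ℤ) ↑ n)
    ≡⟨ cong (λ z → X ↑ j ⊗ (z ⊗ (X ⊗ X ⊖ 1ℤ) ↑ n)) (x²≡8t+1 y) ⟩
  X ↑ j ⊗ ((+ 8 ⊗ T) ⊗ (X ⊗ X ⊖ 1ℤ) ↑ n)
    ≡⟨ move (X ↑ j) T ((X ⊗ X ⊖ 1ℤ) ↑ n) ⟩
  (+ 8 ⊗ T) ⊗ (X ↑ j ⊗ (X ⊗ X ⊖ 1ℤ) ↑ n)
    ≡⟨ cong ((+ 8 ⊗ T) ⊗_) (u≡8^*eval x t x²≡8t+1 j n y) ⟩
  (+ 8 ⊗ T) ⊗ (2^ (3 * n) ⊗ (eval (x ^ᴾ j) y ⊗ eval (t ^ᴾ n) y))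
    ≡⟨ move′ T (2^ (3 * n)) (eval (x ^ᴾ j) y) (eval (t ^ᴾ n) y) ⟩
  (+ 8 ⊗ 2^ (3 * n)) ⊗ (eval (x ^ᴾ j) y ⊗ (T ⊗ eval (t ^ᴾ n) y))
    ≡⟨ cong (_⊗ (eval (x ^ᴾ j) y ⊗ (T ⊗ eval (t ^ᴾ n) y)))
            (trans (sym (2^-+ 3 (3 * n))) (cong 2^ (sym (ℕ.*-suc 3 n)))) ⟩
  2^ (3 * suc n) ⊗ (eval (x ^ᴾ j) y ⊗ (T ⊗ eval (t ^ᴾ n) y)) ∎
  where
  X T : ℤ
  X = eval x y
  T = eval t y
  move : ∀ p t w → p ⊗ ((+ 8 ⊗ t) ⊗ w) ≡ (+ 8 ⊗ t) ⊗ (p ⊗ w)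
  move = solve-∀
  move′ : ∀ t k p w → (+ 8 ⊗ t) ⊗ (k ⊗ (p ⊗ w)) ≡ (+ 8 ⊗ k) ⊗ (p ⊗ (t ⊗ w))
  move′ = solve-∀

x₁²≡8t₁+1 : ∀ y → eval x₁ y ⊗ eval x₁ y ⊖ 1ℤ ≡ + 8 ⊗ eval t₁ y
x₁²≡8t₁+1 = identity
  where
  identity : ∀ y → (+ 1 ⊕ + 4 ⊗ y) ⊗ (+ 1 ⊕ + 4 ⊗ y) ⊖ 1ℤ ≡ + 8 ⊗ (y ⊗ (+ 2 ⊗ y ⊕ 1ℤ))
  identity = solve-∀

x₃²≡8t₃+1 : ∀ y → eval x₃ y ⊗ eval x₃ y ⊖ 1ℤ ≡ + 8 ⊗ eval t₃ y
x₃²≡8t₃+1 = identity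
  where
  identity : ∀ y → (+ 3 ⊕ + 4 ⊗ y) ⊗ (+ 3 ⊕ + 4 ⊗ y) ⊖ 1ℤ ≡ + 8 ⊗ ((y ⊕ 1ℤ) ⊗ (+ 2 ⊗ y ⊕ 1ℤ))
  identity = solve-∀

U≡8^*ΣP : ∀ N j n → U N j n ≡ 2^ (3 * n) ⊗ ΣP N (P j n)
U≡8^*ΣP N j n = trans (Σ<-cong N (λ k _ → term k)) (Σ<-*ˡ N (2^ (3 * n)) (λ k → eval (P j n) (+ k)))
  where
  factor : ∀ c a b → c ⊗ a ⊖ c ⊗ b ≡ c ⊗ (a ⊕ -1ℤ ⊗ b)
  factor = solve-∀
  term : ∀ k → u j n (+ 3 ⊕ + 4 ⊗ + k) ⊖ u j n (+ 1 ⊕ + 4 ⊗ + k) ≡ 2^ (3 * n) ⊗ eval (P j n) (+ k)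
  term k = trans (cong₂ _⊖_ (u≡8^*eval x₃ t₃ x₃²≡8t₃+1 j n (+ k)) (u≡8^*eval x₁ t₁ x₁²≡8t₁+1 j n (+ k)))
    (factor (2^ (3 * n)) (eval (x₃ ^ᴾ j ⊠ t₃ ^ᴾ n) (+ k)) (eval (x₁ ^ᴾ j ⊠ t₁ ^ᴾ n) (+ k)))

-- Since x² = 1 + 8t, two more factors x amount to a factor 1 + 8t.
ΣP-P-step : ∀ N j n → ΣP N (P (2 + j) n) ≡ ΣP N (P j n) ⊕ + 8 ⊗ ΣP N (P j (suc n))
ΣP-P-step zero    j n = refl
ΣP-P-step (suc N) j n = trans
  (cong₂ _⊕_ (ΣP-P-step N j n)
    (term (+ N) (eval (x₃ ^ᴾ j) (+ N)) (eval (t₃ ^ᴾ n) (+ N)) (eval (x₁ ^ᴾ j) (+ N)) (eval (t₁ ^ᴾ n) (+ N))))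
  (rearrange (ΣP N (P j n)) (ΣP N (P j (suc n))) (eval (P j n) (+ N)) (eval (P j (suc n)) (+ N)))
  where
  rearrange : ∀ a b c d → (a ⊕ + 8 ⊗ b) ⊕ (c ⊕ + 8 ⊗ d) ≡ (a ⊕ c) ⊕ + 8 ⊗ (b ⊕ d)
  rearrange = solve-∀
  term : ∀ y a b c d →
    ((+ 3 ⊕ + 4 ⊗ y) ⊗ ((+ 3 ⊕ + 4 ⊗ y) ⊗ a)) ⊗ b ⊕ -1ℤ ⊗ (((+ 1 ⊕ + 4 ⊗ y) ⊗ ((+ 1 ⊕ + 4 ⊗ y) ⊗ c)) ⊗ d)
    ≡ (a ⊗ b ⊕ -1ℤ ⊗ (c ⊗ d))
      ⊕ + 8 ⊗ (a ⊗ (((y ⊕ 1ℤ) ⊗ (+ 2 ⊗ y ⊕ 1ℤ)) ⊗ b) ⊕ -1ℤ ⊗ (c ⊗ ((y ⊗ (+ 2 ⊗ y ⊕ 1ℤ)) ⊗ d)))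
  term = solve-∀

-- The sum of 16 terms modulo 64.

D : ℕ → ℕ → ℤ
D j n = ΣP 16 (P j n)

D-mod-8 : ∀ j n → ∃ λ q → D j n ≡ + 8 ⊗ q
D-mod-8 j n = let q , eq = 2ΣP-mod 4 (P j n) in
  q , *-cancelˡ-≡ (+ 2) (D j n) (+ 8 ⊗ q) (trans eq (*-assoc (+ 2) (+ 8) q))

-- Raising j by 2 adds 8 times another value of `D`, and every value of `D` is itself divisible by
-- 8.
D-mod-64 : ∀ j → j % 2 ≡ 1 → ∀ n → ∃ λ q → D j n ≡ D 1 n ⊕ + 64 ⊗ q
D-mod-64 zero          ()
D-mod-64 (suc zero)    _     n = 0ℤ , sym (+-identityʳ (D 1 n))
D-mod-64 (suc (suc j)) j%2≡1 n =
  let q , eq  = D-mod-64 j j%2≡1 n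
      r , eq′ = D-mod-8 j (suc n)
  in q ⊕ r , combine (D (2 + j) n) (D j n) (D j (suc n)) (D 1 n) q r (ΣP-P-step 16 j n) eq eq′
  where
  combine : ∀ X a b c q r → X ≡ a ⊕ + 8 ⊗ b → a ≡ c ⊕ + 64 ⊗ q → b ≡ + 8 ⊗ r → X ≡ c ⊕ + 64 ⊗ (q ⊕ r)
  combine _ _ _ c q r refl refl refl = collect c q r
    where
    collect : ∀ c q r → (c ⊕ + 64 ⊗ q) ⊕ + 8 ⊗ (+ 8 ⊗ r) ≡ c ⊕ + 64 ⊗ (q ⊕ r)
    collect = solve-∀

-- Modulo 64 the sixth power of an even number vanishes and the order of an odd number divides 16,
-- whence the exponents 6 and 22 = 6 + 16. Multiplying by t^m gives all later exponents.
↑-periodic : ∀ t → + 64 ∣ t ↑ 22 ⊖ t ↑ 6 → ∀ m → ∃ λ q → t ↑ (22 + m) ≡ t ↑ (6 + m) ⊕ + 64 ⊗ q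
↑-periodic t (divides q eq) m = q ⊗ t ↑ m , (begin
  t ↑ (22 + m)
    ≡⟨ ^-distribˡ-+-* t 22 m ⟩
  t ↑ 22 ⊗ t ↑ m
    ≡⟨ split (t ↑ 22) (t ↑ 6) (t ↑ m) ⟩
  t ↑ 6 ⊗ t ↑ m ⊕ (t ↑ 22 ⊖ t ↑ 6) ⊗ t ↑ m
    ≡⟨ cong₂ (λ a b → a ⊕ b ⊗ t ↑ m) (sym (^-distribˡ-+-* t 6 m)) eq ⟩
  t ↑ (6 + m) ⊕ (q ⊗ + 64) ⊗ t ↑ m
    ≡⟨ cong (t ↑ (6 + m) ⊕_) (swap q (t ↑ m)) ⟩
  t ↑ (6 + m) ⊕ + 64 ⊗ (q ⊗ t ↑ m) ∎)
  where
  split : ∀ a b c → a ⊗ c ≡ b ⊗ c ⊕ (a ⊖ b) ⊗ c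
  split = solve-∀
  swap : ∀ q c → (q ⊗ + 64) ⊗ c ≡ + 64 ⊗ (q ⊗ c)
  swap = solve-∀

t-periodic : ∀ {k} → k < 16 → ∀ m →
  (∃ λ q → eval (t₁ ^ᴾ (22 + m)) (+ k) ≡ eval (t₁ ^ᴾ (6 + m)) (+ k) ⊕ + 64 ⊗ q) ×
  (∃ λ q → eval (t₃ ^ᴾ (22 + m)) (+ k) ≡ eval (t₃ ^ᴾ (6 + m)) (+ k) ⊕ + 64 ⊗ q)
t-periodic {k} k<16 m =
  -- The hypothesis of `↑-periodic` is decided by evaluation for all k < 16.
  lift t₁ (↑-periodic (eval t₁ (+ k)) (toWitness {a? = allUpTo? (check t₁) 16} _ k<16) m) ,
  lift t₃ (↑-periodic (eval t₃ (+ k)) (toWitness {a? = allUpTo? (check t₃) 16} _ k<16) m)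
  where
  check : ∀ t k → Dec (+ 64 ∣ eval t (+ k) ↑ 22 ⊖ eval t (+ k) ↑ 6)
  check t k = + 64 ∣? _
  lift : ∀ t → (∃ λ q → eval t (+ k) ↑ (22 + m) ≡ eval t (+ k) ↑ (6 + m) ⊕ + 64 ⊗ q) →
         ∃ λ q → eval (t ^ᴾ (22 + m)) (+ k) ≡ eval (t ^ᴾ (6 + m)) (+ k) ⊕ + 64 ⊗ q
  lift t (q , eq) = q , trans (eval-^ᴾ t (22 + m) (+ k))
    (trans eq (cong (_⊕ + 64 ⊗ q) (sym (eval-^ᴾ t (6 + m) (+ k)))))

ΣP-P-periodic : ∀ j m N → N ≤ 16 → ∃ λ q → ΣP N (P j (22 + m)) ≡ ΣP N (P j (6 + m)) ⊕ + 64 ⊗ q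
ΣP-P-periodic j m zero    _    = 0ℤ , refl
ΣP-P-periodic j m (suc N) N<16 =
  let q , eq            = ΣP-P-periodic j m N (ℕ.<⇒≤ N<16)
      (r , eq₁) , s , eq₃ = t-periodic N<16 m
      a = eval (x₃ ^ᴾ j) (+ N)
      b = eval (x₁ ^ᴾ j) (+ N)
  in q ⊕ a ⊗ s ⊖ b ⊗ r ,
     combine (ΣP N (P j (22 + m))) (ΣP N (P j (6 + m))) a b
             (eval (t₃ ^ᴾ (22 + m)) (+ N)) (eval (t₃ ^ᴾ (6 + m)) (+ N))
             (eval (t₁ ^ᴾ (22 + m)) (+ N)) (eval (t₁ ^ᴾ (6 + m)) (+ N)) q r s eq eq₁ eq₃
  where
  combine : ∀ X Y a b c c′ d d′ q r s → X ≡ Y ⊕ + 64 ⊗ q → d ≡ d′ ⊕ + 64 ⊗ r → c ≡ c′ ⊕ + 64 ⊗ s →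
            X ⊕ (a ⊗ c ⊕ -1ℤ ⊗ (b ⊗ d)) ≡ (Y ⊕ (a ⊗ c′ ⊕ -1ℤ ⊗ (b ⊗ d′))) ⊕ + 64 ⊗ (q ⊕ a ⊗ s ⊖ b ⊗ r)
  combine _ Y a b _ c′ _ d′ q r s refl refl refl = collect Y a b c′ d′ q r s
    where
    collect : ∀ Y a b c d q r s →
      (Y ⊕ + 64 ⊗ q) ⊕ (a ⊗ (c ⊕ + 64 ⊗ s) ⊕ -1ℤ ⊗ (b ⊗ (d ⊕ + 64 ⊗ r)))
      ≡ (Y ⊕ (a ⊗ c ⊕ -1ℤ ⊗ (b ⊗ d))) ⊕ + 64 ⊗ (q ⊕ a ⊗ s ⊖ b ⊗ r)
    collect = solve-∀

D-periodic : ∀ j m → ∃ λ q → D j (22 + m) ≡ D j (6 + m) ⊕ + 64 ⊗ q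
D-periodic j m = ΣP-P-periodic j m 16 ≤-refl
-- The congruence `D 1 n` ≡ `residue n` modulo `modulus n` says that the exact power of 2 in `D 1 n`
-- is 2^4 for even n and 2^5 for odd n.
modulus residue : ℕ → ℤ
modulus n = if isEven n then + 32 else + 64
residue n = if isEven n then + 16 else + 32

modulus∣64 : ∀ n → modulus n ∣ + 64
modulus∣64 n with isEven n
... | true  = divides (+ 2) refl
... | false = divides (+ 1) refl

-- A record, so that comparing HasResidue m with HasResidue n never unfolds the 16-term sum D.
record HasResidue (n : ℕ) : Set where
  constructor hasResidue
  field divisible : modulus n ∣ D 1 n ⊖ residue n

hasResidue? : ∀ n → Dec (HasResidue n)
hasResidue? n = map′ hasResidue HasResidue.divisible (modulus n ∣? D 1 n ⊖ residue n)

hasResidue-periodic : ∀ m → HasResidue (6 + m) → HasResidue (22 + m)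
hasResidue-periodic m (hasResidue d) = hasResidue
  (transfer (modulus (6 + m)) (modulus (22 + m)) (residue (6 + m)) (residue (22 + m)) (D 1 (6 + m)) (D 1 (22 + m))
            -- `isEven` descends by two, so the data at 6 + m and at 22 + m agree definitionally
            -- with those at m.
            refl refl (modulus∣64 m) (D-periodic 1 m) d)
  where
  transfer : ∀ M M′ r r′ Y X → M ≡ M′ → r ≡ r′ → M ∣ + 64 → (∃ λ q → X ≡ Y ⊕ + 64 ⊗ q) →
             M ∣ Y ⊖ r → M′ ∣ X ⊖ r′
  transfer M _ r _ Y _ refl refl M∣64 (q , refl) M∣Y-r = subst (M ∣_) (collect Y r q)
    (∣m∣n⇒∣m+n M∣Y-r (∣n⇒∣m*n q M∣64))
    where
    collect : ∀ Y r q → (Y ⊖ r) ⊕ q ⊗ + 64 ≡ (Y ⊕ + 64 ⊗ q) ⊖ r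
    collect = solve-∀

hasResidue-6+ : ∀ q {r} → r < 16 → HasResidue (6 + (r + q * 16))
hasResidue-6+ q {r} r<16 = subst (λ m → HasResidue (6 + m)) (ℕ.+-comm (q * 16) r) (go q)
  where
  go : ∀ q → HasResidue (6 + (q * 16 + r))
  -- One full period, the exponents 6 to 21, is evaluated.
  go zero    = toWitness {a? = allUpTo? (λ r → hasResidue? (6 + r)) 16} _ r<16
  go (suc q) = hasResidue-periodic (q * 16 + r) (go q)

-- The exponents 2 to 5 precede the periodic range and are evaluated separately. The exponents 0 and
-- 1 are left out because there the two parities exchange their valuations.
hasResidue-2+ : ∀ n → HasResidue (2 + n)
hasResidue-2+ 0 = toWitness {a? = hasResidue? 2} _
hasResidue-2+ 1 = toWitness {a? = hasResidue? 3} _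
hasResidue-2+ 2 = toWitness {a? = hasResidue? 4} _
hasResidue-2+ 3 = toWitness {a? = hasResidue? 5} _
hasResidue-2+ (suc (suc (suc (suc n)))) =
  subst (λ m → HasResidue (6 + m)) (sym (m≡m%n+[m/n]*n n 16)) (hasResidue-6+ (n / 16) (m%n<n n 16))

isEven≡true : ∀ n → n % 2 ≡ 0 → isEven n ≡ true
isEven≡true zero          _ = refl
isEven≡true (suc (suc n)) p = isEven≡true n p

isEven≡false : ∀ n → n % 2 ≡ 1 → isEven n ≡ false
isEven≡false (suc zero)    _ = refl
isEven≡false (suc (suc n)) p = isEven≡false n p

D-even : ∀ n → (2 + n) % 2 ≡ 0 → ∃ λ q → D 1 (2 + n) ≡ + 16 ⊕ + 32 ⊗ q
D-even n even = from (D 1 (2 + n)) (isEven n) (isEven≡true n even) (HasResidue.divisible (hasResidue-2+ n))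
  where
  -- Abstracting the parity as `b` lets the match on `b ≡ true` reduce both conditionals.
  from : ∀ X b → b ≡ true → (if b then + 32 else + 64) ∣ X ⊖ (if b then + 16 else + 32) →
         ∃ λ q → X ≡ + 16 ⊕ + 32 ⊗ q
  from X _ refl (divides q eq) = q , trans (add-back X) (trans (cong (_⊕ + 16) eq) (collect q))
    where
    add-back : ∀ X → X ≡ (X ⊖ + 16) ⊕ + 16
    add-back = solve-∀
    collect : ∀ q → q ⊗ + 32 ⊕ + 16 ≡ + 16 ⊕ + 32 ⊗ q
    collect = solve-∀

D-odd : ∀ n → (2 + n) % 2 ≡ 1 → ∃ λ q → D 1 (2 + n) ≡ + 32 ⊕ + 64 ⊗ q
D-odd n odd = from (D 1 (2 + n)) (isEven n) (isEven≡false n odd) (HasResidue.divisible (hasResidue-2+ n))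
  where
  from : ∀ X b → b ≡ false → (if b then + 32 else + 64) ∣ X ⊖ (if b then + 16 else + 32) →
         ∃ λ q → X ≡ + 32 ⊕ + 64 ⊗ q
  from X _ refl (divides q eq) = q , trans (add-back X) (trans (cong (_⊕ + 32) eq) (collect q))
    where
    add-back : ∀ X → X ≡ (X ⊖ + 32) ⊕ + 32
    add-back = solve-∀
    collect : ∀ q → q ⊗ + 64 ⊕ + 32 ≡ + 32 ⊕ + 64 ⊗ q
    collect = solve-∀

-- From the 16-term sum to the valuation of `S`.

-- With K = 2^(3n) and N = 16K, `U` is both 32K · S + 2048K² · q and K² · (D + 64r). Cancelling K
-- leaves an error 2048K · q, still a multiple of 64K.
32S-mod : ∀ j n → ∃ λ q → + 32 ⊗ S j n ≡ 2^ (3 * n) ⊗ (D j n ⊕ + 64 ⊗ q)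
32S-mod j n =
  let q , eq  = U-mod (2 ^ (4 + 3 * n)) j n
      r , eq′ = ΣP-16-mod (3 * n) (P j n)
  in r ⊖ + 32 ⊗ q ,
     combine (2^ (3 * n)) {{ℕ.m^n≢0 2 (3 * n)}} (2^ (4 + 3 * n)) (U (2 ^ (4 + 3 * n)) j n) (S j n)
             (ΣP (2 ^ (4 + 3 * n)) (P j n)) (D j n) q r
             (2^-+ 4 (3 * n)) eq (U≡8^*ΣP (2 ^ (4 + 3 * n)) j n) eq′
  where
  combine : ∀ K {{_ : NonZero ∣ K ∣}} H U S I D q r → H ≡ + 16 ⊗ K →
            U ≡ + 2 ⊗ H ⊗ S ⊕ + 8 ⊗ (H ⊗ H) ⊗ q → U ≡ K ⊗ I → I ≡ K ⊗ (D ⊕ + 64 ⊗ r) →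
            + 32 ⊗ S ≡ K ⊗ (D ⊕ + 64 ⊗ (r ⊖ + 32 ⊗ q))
  combine K _ U S _ D q r refl eq U≡K[I] refl = *-cancelˡ-≡ K (+ 32 ⊗ S) _
    (trans (isolate K S q)
    (trans (cong (_⊖ + 8 ⊗ ((+ 16 ⊗ K) ⊗ (+ 16 ⊗ K)) ⊗ q) (trans (sym eq) U≡K[I]))
           (collect K D q r)))
    where
    isolate : ∀ K S q → K ⊗ (+ 32 ⊗ S) ≡
      (+ 2 ⊗ (+ 16 ⊗ K) ⊗ S ⊕ + 8 ⊗ ((+ 16 ⊗ K) ⊗ (+ 16 ⊗ K)) ⊗ q) ⊖ + 8 ⊗ ((+ 16 ⊗ K) ⊗ (+ 16 ⊗ K)) ⊗ q
    isolate = solve-∀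
    collect : ∀ K D q r → K ⊗ (K ⊗ (D ⊕ + 64 ⊗ r)) ⊖ + 8 ⊗ ((+ 16 ⊗ K) ⊗ (+ 16 ⊗ K)) ⊗ q
            ≡ K ⊗ (K ⊗ (D ⊕ + 64 ⊗ (r ⊖ + 32 ⊗ q)))
    collect = solve-∀

highestPow2 : ∀ m z q → z ≡ 2^ m ⊗ (1ℤ ⊕ + 2 ⊗ q) → HighestPow2 m z
highestPow2 m z q eq = ∣⇒∣ᵤ (divides (1ℤ ⊕ + 2 ⊗ q) (trans eq (*-comm (2^ m) (1ℤ ⊕ + 2 ⊗ q)))) ,
  -- One more factor 2 would make the odd cofactor even, so that 2 would divide 1.
  λ 2^1+m∣z → contradiction (∣⇒∣ᵤ (2∣1 (∣ᵤ⇒∣ 2^1+m∣z))) (from-no (2 ℕ.∣? 1))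
  where
  2∣1 : 2^ (suc m) ∣ z → + 2 ∣ 1ℤ
  2∣1 (divides r eq′) = divides (r ⊖ q) (combine r q (*-cancelˡ-≡ (2^ m) (1ℤ ⊕ + 2 ⊗ q) (+ 2 ⊗ r) {{ℕ.m^n≢0 2 m}} (begin
    2^ m ⊗ (1ℤ ⊕ + 2 ⊗ q) ≡⟨ eq ⟨
    z                     ≡⟨ eq′ ⟩
    r ⊗ 2^ (suc m)        ≡⟨ cong (r ⊗_) (2^-suc m) ⟩
    r ⊗ (+ 2 ⊗ 2^ m)      ≡⟨ move r (2^ m) ⟩
    2^ m ⊗ (+ 2 ⊗ r)      ∎)))
    where
    move : ∀ r k → r ⊗ (+ 2 ⊗ k) ≡ k ⊗ (+ 2 ⊗ r)
    move = solve-∀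
    combine : ∀ r q → 1ℤ ⊕ + 2 ⊗ q ≡ + 2 ⊗ r → 1ℤ ≡ (r ⊖ q) ⊗ + 2
    combine r q eq″ = trans (isolate q) (trans (cong (_⊖ + 2 ⊗ q) eq″) (collect r q))
      where
      isolate : ∀ q → 1ℤ ≡ (1ℤ ⊕ + 2 ⊗ q) ⊖ + 2 ⊗ q
      isolate = solve-∀
      collect : ∀ r q → + 2 ⊗ r ⊖ + 2 ⊗ q ≡ (r ⊖ q) ⊗ + 2
      collect = solve-∀

S-highestPow2-32 : ∀ j n → j % 2 ≡ 1 → (∃ λ q → D 1 n ≡ + 32 ⊕ + 64 ⊗ q) → HighestPow2 (3 * n) (S j n)
S-highestPow2-32 j n j%2≡1 (q , eq) =
  let r , eq′ = D-mod-64 j j%2≡1 n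
      s , eq″ = 32S-mod j n
  in highestPow2 (3 * n) (S j n) (q ⊕ r ⊕ s) (combine (2^ (3 * n)) (S j n) (D j n) (D 1 n) q r s eq eq′ eq″)
  where
  combine : ∀ K S D D₁ q r s → D₁ ≡ + 32 ⊕ + 64 ⊗ q → D ≡ D₁ ⊕ + 64 ⊗ r →
            + 32 ⊗ S ≡ K ⊗ (D ⊕ + 64 ⊗ s) → S ≡ K ⊗ (1ℤ ⊕ + 2 ⊗ (q ⊕ r ⊕ s))
  combine K S _ _ q r s refl refl eq = *-cancelˡ-≡ (+ 32) S _ (trans eq (collect K q r s))
    where
    collect : ∀ K q r s → K ⊗ (((+ 32 ⊕ + 64 ⊗ q) ⊕ + 64 ⊗ r) ⊕ + 64 ⊗ s)
                        ≡ + 32 ⊗ (K ⊗ (1ℤ ⊕ + 2 ⊗ (q ⊕ r ⊕ s)))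
    collect = solve-∀

-- Here `D` is an odd multiple of 16 only, so the missing factor 2 is taken from 2^(3(n+1)), which
-- lowers the exponent by one.
S-highestPow2-16 : ∀ j n → j % 2 ≡ 1 → (∃ λ q → D 1 (suc n) ≡ + 16 ⊕ + 32 ⊗ q) →
                   HighestPow2 (3 * suc n ∸ 1) (S j (suc n))
S-highestPow2-16 j n j%2≡1 (q , eq) =
  let r , eq′ = D-mod-64 j j%2≡1 (suc n)
      s , eq″ = 32S-mod j (suc n)
  in highestPow2 (3 * suc n ∸ 1) (S j (suc n)) (q ⊕ + 2 ⊗ (r ⊕ s))
       (combine (2^ (3 * suc n)) (2^ (3 * suc n ∸ 1)) (S j (suc n)) (D j (suc n)) (D 1 (suc n))
                q r s (2^-suc (3 * suc n ∸ 1)) eq eq′ eq″)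
  where
  combine : ∀ K L S D D₁ q r s → K ≡ + 2 ⊗ L → D₁ ≡ + 16 ⊕ + 32 ⊗ q → D ≡ D₁ ⊕ + 64 ⊗ r →
            + 32 ⊗ S ≡ K ⊗ (D ⊕ + 64 ⊗ s) → S ≡ L ⊗ (1ℤ ⊕ + 2 ⊗ (q ⊕ + 2 ⊗ (r ⊕ s)))
  combine _ L S _ _ q r s refl refl refl eq = *-cancelˡ-≡ (+ 32) S _ (trans eq (collect L q r s))
    where
    collect : ∀ L q r s → (+ 2 ⊗ L) ⊗ (((+ 16 ⊕ + 32 ⊗ q) ⊕ + 64 ⊗ r) ⊕ + 64 ⊗ s)
                        ≡ + 32 ⊗ (L ⊗ (1ℤ ⊕ + 2 ⊗ (q ⊕ + 2 ⊗ (r ⊕ s))))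
    collect = solve-∀

theorem9p2 : (j : ℕ) → j % 2 ≡ 1 →
    HighestPow2 0 (S j 0)
    × HighestPow2 2 (S j 1)
    × ((n : ℕ) → 1 < n →
    (n % 2 ≡ 1 → HighestPow2 (3 * n) (S j n))
    × (n % 2 ≡ 0 → HighestPow2 (3 * n ∸ 1) (S j n)))
theorem9p2 j j%2≡1 =
  -- `D 1 0` = 32, as each of its 16 terms is (4k + 3) - (4k + 1) = 2.
  S-highestPow2-32 j 0 j%2≡1 (0ℤ , refl) ,
  -- The terms of `D 1 1` are 12k² + 12k + 3, with sum 16368 = 16 + 32 · 511.
  S-highestPow2-16 j 0 j%2≡1 (+ 511 , refl) ,
  λ { (suc (suc n)) (s≤s (s≤s z≤n)) →
      (λ odd  → S-highestPow2-32 j (2 + n) j%2≡1 (D-odd n odd)) ,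
      (λ even → S-highestPow2-16 j (1 + n) j%2≡1 (D-even n even)) }
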